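{- Let $n\ge 2$ and set $k=\lfloor n/2\rfloor$. Let $P_n$ be the path on vertices $v_1,\dots,v_n$ with edges $v_iv_{i+1}$ ($1\le i\le n-1$). Let $E_n$ (resp. $O_n$) be the graph obtained from $P_n$ by attaching one pendant vertex $\ell_i$ (adjacent only to $v_i$) to each vertex $v_i$ with $i$ even (resp. $i$ odd). Then $$\gamma(E_n)=k,\qquad \zeta(E_n)=\begin{cases}F_{k+1},& n=2k,\\ F_k,& n=2k+1,\end{cases}$$ and $$\gamma(O_n)=\lceil n/2\rceil,\qquad \zeta(O_n)=\begin{cases}F_{k+1},& n=2k,\\ F_{k+3},& n=2k+1,\end{cases}$$ where $(F_t)_{t\ge 1}$ is the Fibonacci sequence defined by $F_1=F_2=1$ and $F_{t+1}=F_t+F_{t-1}$.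
   Context: For a finite simple graph $G$, a set $D\subseteq V(G)$ is dominating if every vertex of $G$ lies in $D$ or has a neighbor in $D$. The domination number $\gamma(G)$ is the minimum size of a dominating set. The dominion $\zeta(G)$ is the number of dominating sets of $G$ of size $\gamma(G)$. -}

module Defs where

open import Data.Empty using (⊥)
open import Data.Fin using (Fin; toℕ; splitAt)
open import Data.Fin.Properties using (all?; any?) renaming (_≟_ to _≟ᶠ_)
open import Data.Fin.Subset using (Subset; inside; outside; _∈_; ∣_∣)
open import Data.Fin.Subset.Properties using (_∈?_)
open import Data.List using (List; []; _∷_; _++_; map; filter; length; lookup; allFin)
open import Data.List.Extrema.Nat using (min)
open import Data.Nat using (ℕ; zero; suc; _+_)
open import Data.Nat.Divisibility using (_∣_; _∣?_)
open import Data.Nat.Properties using (_≟_; 1+n≢n)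
open import Data.Product using (_×_; ∃-syntax)
open import Data.Sum using (_⊎_; inj₁; inj₂; swap)
import Data.Vec as Vec
open import Function using (_on_)
open import Level using (0ℓ)
open import Relation.Binary using (Rel; Symmetric; Irreflexive; Decidable)
open import Relation.Binary.PropositionalEquality using (_≡_; refl)
open import Relation.Nullary using (yes; no; ¬?)
open import Relation.Nullary.Decidable using (_⊎-dec_; _×-dec_)
import Relation.Unary as U

record Graph (n : ℕ) : Set₁ where
  field
    Adj    : Rel (Fin n) 0ℓ
    sym    : Symmetric Adj
    irrefl : Irreflexive _≡_ Adj
    adj?   : Decidable Adj

open Graph

Dominating : ∀ {n} → Graph n → Subset n → Set
Dominating G D = ∀ v → v ∈ D ⊎ (∃[ u ] u ∈ D × Adj G v u)

dominating? : ∀ {n} (G : Graph n) → U.Decidable (Dominating G)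
dominating? G D =
  all? λ v → (v ∈? D) ⊎-dec any? λ u → (u ∈? D) ×-dec adj? G v u

-- Every subset of Fin n occurs exactly once.
subsets : ∀ n → List (Subset n)
subsets zero    = Vec.[] ∷ []
subsets (suc n) =
  map (outside Vec.∷_) (subsets n) ++ map (inside Vec.∷_) (subsets n)

dominatingSets : ∀ {n} → Graph n → List (Subset n)
dominatingSets {n} G = filter (dominating? G) (subsets n)

-- The default value n for the minimum is the size of the full vertex set,
-- which is itself dominating, so it never affects the result.
γ : ∀ {n} → Graph n → ℕ
γ {n} G = min n (map ∣_∣ (dominatingSets G))

ζ : ∀ {n} → Graph n → ℕ
ζ G = length (filter (λ D → ∣ D ∣ ≟ γ G) (dominatingSets G))

-- The vertex vᵢ is the element i ∸ 1 of Fin n.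
path : ∀ n → Graph n
path n = record
  { Adj    = λ i j → suc (toℕ i) ≡ toℕ j ⊎ suc (toℕ j) ≡ toℕ i
  ; sym    = swap
  ; irrefl = λ { refl (inj₁ e) → 1+n≢n e ; refl (inj₂ e) → 1+n≢n e }
  ; adj?   = λ i j → (suc (toℕ i) ≟ toℕ j) ⊎-dec (suc (toℕ j) ≟ toℕ i)
  }

-- One new vertex for each entry of the list, adjacent only to that entry.
-- In Fin (n + length hosts) the old vertices come first.
module _ {n} (G : Graph n) (hosts : List (Fin n)) where

  private
    Vertex : Set
    Vertex = Fin n ⊎ Fin (length hosts)

  PendantAdj : Rel Vertex 0ℓ
  PendantAdj (inj₁ i) (inj₁ j) = Adj G i j
  PendantAdj (inj₁ i) (inj₂ l) = i ≡ lookup hosts l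
  PendantAdj (inj₂ l) (inj₁ i) = i ≡ lookup hosts l
  PendantAdj (inj₂ _) (inj₂ _) = ⊥

  pendantAdj-sym : Symmetric PendantAdj
  pendantAdj-sym {inj₁ _} {inj₁ _} e = sym G e
  pendantAdj-sym {inj₁ _} {inj₂ _} e = e
  pendantAdj-sym {inj₂ _} {inj₁ _} e = e

  pendantAdj-irrefl : Irreflexive _≡_ PendantAdj
  pendantAdj-irrefl {inj₁ _} refl e = irrefl G refl e

  pendantAdj? : Decidable PendantAdj
  pendantAdj? (inj₁ i) (inj₁ j) = adj? G i j
  pendantAdj? (inj₁ i) (inj₂ l) = i ≟ᶠ lookup hosts l
  pendantAdj? (inj₂ l) (inj₁ i) = i ≟ᶠ lookup hosts l
  pendantAdj? (inj₂ _) (inj₂ _) = no λ ()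

  attachPendants : Graph (n + length hosts)
  attachPendants = record
    { Adj    = PendantAdj on splitAt n
    ; sym    = λ {u} {v} → pendantAdj-sym {splitAt n u} {splitAt n v}
    ; irrefl = λ { {u} refl → pendantAdj-irrefl {splitAt n u} refl }
    ; adj?   = λ u v → pendantAdj? (splitAt n u) (splitAt n v)
    }

evenVertices oddVertices : ∀ n → List (Fin n)
evenVertices n = filter (λ i → 2 ∣? suc (toℕ i)) (allFin n)
oddVertices  n = filter (λ i → ¬? (2 ∣? suc (toℕ i))) (allFin n)

E : ∀ n → Graph (n + length (evenVertices n))
E n = attachPendants (path n) (evenVertices n)

O : ∀ n → Graph (n + length (oddVertices n))
O n = attachPendants (path n) (oddVertices n)

-- F 1 = F 2 = 1; the value F 0 = 0 extends the recurrence downwards.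
F : ℕ → ℕ
F zero          = 0
F (suc zero)    = 1
F (suc (suc t)) = F (suc t) + F t

{-# OPTIONS --safe #-}
-- A dominating set of a graph with pendants contains, for each pendant ℓ, either ℓ or its
-- host.  If the hosts are distinct and dominate the base graph, then the minimum dominating
-- sets choose exactly one of the two for every pendant and contain nothing else, so they
-- correspond to the sets b of chosen hosts next to which every non-host vertex lies.  On a
-- path whose hosts are every other vertex, this says that the 0/1 sequence of choices has no
-- two consecutive zeros, an end of the path at a host imposing no condition there and an end
-- at a non-host forcing the nearest host.  Such sequences are counted by Fibonacci numbers.
module Submission where

open import Defs
open import Data.Bool using (Bool; true; false; not; _∨_; T)
open import Data.Bool.Properties using (T?; not-involutive)
open import Data.Empty using (⊥-elim)
open import Data.Fin using (Fin; zero; suc; toℕ; fromℕ<; splitAt; join)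
open import Data.Fin.Properties
  using (toℕ-injective; toℕ<n; toℕ-fromℕ<; splitAt-join)
  renaming (suc-injective to suc-injectiveᶠ)
open import Data.Fin.Subset
  using (Subset; inside; outside; _∈_; _⊆_; ∣_∣; ∁; ⁅_⁆; _∪_; ⊤; ⊥)
open import Data.Fin.Subset.Properties
  using (_∈?_; ∉⊥; ∣⊥∣≡0; x∈⁅x⁆; x∈⁅y⁆⇒x≡y; x∈p∪q⁻; x∈p∪q⁺; p⊆q⇒∣p∣≤∣q∣;
    drop-∷-⊆; x∈∁p⇒x∉p; x∉p⇒x∈∁p; ∣∁p∣≡n∸∣p∣; ∣p∣≤n)
open import Data.List
  using (List; []; _∷_; _++_; map; filter; length; lookup; tabulate; applyUpTo; allFin)
open import Data.List.Extrema.Nat using (f[argmin]≈f[v]⁺)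
open import Data.List.Membership.Propositional using () renaming (_∈_ to _∈ˡ_)
open import Data.List.Membership.Propositional.Properties
  using (∈-map⁺; ∈-map⁻; ∈-++⁺ˡ; ∈-++⁺ʳ; ∈-filter⁺; ∈-filter⁻)
open import Data.List.Membership.Propositional.Properties.WithK using (unique∧set⇒bag)
open import Data.List.Properties
  using (length-map; length-++; filter-++; filter-≐; filter-none; filter-accept;
    filter-reject; map-tabulate; ∷-injectiveˡ; ∷-injectiveʳ)
open import Data.List.Relation.Binary.BagAndSetEquality using (∼bag⇒↭)
open import Data.List.Relation.Binary.Permutation.Propositional.Properties using (↭-length)
import Data.List.Relation.Unary.All as All
import Data.List.Relation.Unary.All.Properties as All
import Data.List.Relation.Unary.Any as Any
open import Data.List.Relation.Unary.AllPairs using ([]; _∷_)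
open import Data.List.Relation.Unary.Unique.Propositional using (Unique)
import Data.List.Relation.Unary.Unique.Propositional.Properties as Unique
open import Data.Nat
  using (ℕ; zero; suc; _+_; _*_; _≤_; _<_; z≤n; s≤s; s≤s⁻¹; ⌊_/2⌋; ⌈_/2⌉)
open import Data.Nat.Divisibility using (_∣_; _∣?_; divides; ∣-refl)
open import Data.Nat.Properties
open import Data.Product using (_×_; _,_; proj₁; proj₂; ∃-syntax)
open import Data.Sum using (_⊎_; inj₁; inj₂; [_,_]′)
import Data.Vec as Vec
open Vec using (here; there)
import Data.Vec.Properties as Vec
open import Function using (_∘_; id)
open import Function.Bundles using (_⇔_; mk⇔; Equivalence)
open import Function.Definitions using (Injective)
open import Relation.Binary.PropositionalEquality
open import Relation.Nullary using (¬_; ¬?; yes; no; contradiction)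
open import Relation.Nullary.Decidable using (_×-dec_)
import Relation.Unary as U

open Equivalence using (to; from)

private
  variable
    m n : ℕ
    A B : Set

-- Filtering and counting in lists.

map-filter : {P : B → Set} (P? : U.Decidable P) (f : A → B) (xs : List A) →
  map f (filter (P? ∘ f) xs) ≡ filter P? (map f xs)
map-filter P? f []       = refl
map-filter P? f (x ∷ xs) with P? (f x)
... | yes _ = cong (f x ∷_) (map-filter P? f xs)
... | no  _ = map-filter P? f xs

length-filter-map : {P : B → Set} (P? : U.Decidable P) (f : A → B) (xs : List A) →
  length (filter P? (map f xs)) ≡ length (filter (P? ∘ f) xs)
length-filter-map P? f xs =
  trans (cong length (sym (map-filter P? f xs))) (length-map f (filter (P? ∘ f) xs))

-- Duplicate-free lists with the same members are permutations of each other. This turns the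
-- correspondence between minimum dominating sets and choices of hosts into an equality of counts.
unique∧set⇒length≡ : {xs ys : List A} → Unique xs → Unique ys →
  (∀ {z} → z ∈ˡ xs ⇔ z ∈ˡ ys) → length xs ≡ length ys
unique∧set⇒length≡ xs! ys! eq = ↭-length (∼bag⇒↭ (unique∧set⇒bag xs! ys! eq))

-- Subsets of a finite set

∈-subsets : (p : Subset n) → p ∈ˡ subsets n
∈-subsets Vec.[]             = Any.here refl
∈-subsets (outside Vec.∷ p) = ∈-++⁺ˡ (∈-map⁺ _ (∈-subsets p))
∈-subsets (inside  Vec.∷ p) = ∈-++⁺ʳ _ (∈-map⁺ _ (∈-subsets p))

subsets-unique : ∀ n → Unique (subsets n)
subsets-unique zero    = All.[] ∷ []
subsets-unique (suc n) = Unique.++⁺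
  (Unique.map⁺ Vec.∷-injectiveʳ (subsets-unique n))
  (Unique.map⁺ Vec.∷-injectiveʳ (subsets-unique n))
  λ (p , q) → case-disjoint (∈-map⁻ _ p) (∈-map⁻ _ q)
  where
  case-disjoint : ∀ {z} → ∃[ x ] (x ∈ˡ subsets n × z ≡ outside Vec.∷ x) →
    ¬ (∃[ x ] (x ∈ˡ subsets n × z ≡ inside Vec.∷ x))
  case-disjoint (_ , _ , refl) (_ , _ , ())

∁-involutive : (p : Subset n) → ∁ (∁ p) ≡ p
∁-involutive Vec.[]      = refl
∁-involutive (x Vec.∷ p) = cong₂ Vec._∷_ (not-involutive x) (∁-involutive p)

∣p∣+∣∁p∣≡n : (p : Subset n) → ∣ p ∣ + ∣ ∁ p ∣ ≡ n
∣p∣+∣∁p∣≡n p = trans (cong (∣ p ∣ +_) (∣∁p∣≡n∸∣p∣ p)) (m+[n∸m]≡n (∣p∣≤n p))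

∣p++q∣≡∣p∣+∣q∣ : (p : Subset m) (q : Subset n) → ∣ p Vec.++ q ∣ ≡ ∣ p ∣ + ∣ q ∣
∣p++q∣≡∣p∣+∣q∣ Vec.[]             q = refl
∣p++q∣≡∣p∣+∣q∣ (inside  Vec.∷ p) q = cong suc (∣p++q∣≡∣p∣+∣q∣ p q)
∣p++q∣≡∣p∣+∣q∣ (outside Vec.∷ p) q = ∣p++q∣≡∣p∣+∣q∣ p q

p⊆q∧∣q∣≤∣p∣⇒p≡q : {p q : Subset n} → p ⊆ q → ∣ q ∣ ≤ ∣ p ∣ → p ≡ q
p⊆q∧∣q∣≤∣p∣⇒p≡q {p = Vec.[]} {Vec.[]} p⊆q q≤p = refl
p⊆q∧∣q∣≤∣p∣⇒p≡q {p = outside Vec.∷ p} {outside Vec.∷ q} p⊆q q≤p =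
  cong (outside Vec.∷_) (p⊆q∧∣q∣≤∣p∣⇒p≡q (drop-∷-⊆ p⊆q) q≤p)
p⊆q∧∣q∣≤∣p∣⇒p≡q {p = inside Vec.∷ p} {inside Vec.∷ q} p⊆q q≤p =
  cong (inside Vec.∷_) (p⊆q∧∣q∣≤∣p∣⇒p≡q (drop-∷-⊆ p⊆q) (s≤s⁻¹ q≤p))
p⊆q∧∣q∣≤∣p∣⇒p≡q {p = outside Vec.∷ p} {inside Vec.∷ q} p⊆q q≤p =
  contradiction (≤-trans q≤p (p⊆q⇒∣p∣≤∣q∣ (drop-∷-⊆ p⊆q))) (<-irrefl refl)
p⊆q∧∣q∣≤∣p∣⇒p≡q {p = inside Vec.∷ p} {outside Vec.∷ q} p⊆q q≤p with () ← p⊆q here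

∣⁅x⁆∪p∣ : {x : Fin n} (p : Subset n) → ¬ x ∈ p → ∣ ⁅ x ⁆ ∪ p ∣ ≡ suc ∣ p ∣
∣⁅x⁆∪p∣ {x = zero} (inside  Vec.∷ p) x∉p = contradiction here x∉p
∣⁅x⁆∪p∣ {x = zero} (outside Vec.∷ p) x∉p = cong (suc ∘ ∣_∣) (⊥∪p p)
  where
  ⊥∪p : (p : Subset n) → ⊥ ∪ p ≡ p
  ⊥∪p Vec.[]      = refl
  ⊥∪p (x Vec.∷ p) = cong (x Vec.∷_) (⊥∪p p)
∣⁅x⁆∪p∣ {x = suc x} (inside  Vec.∷ p) x∉p = cong suc (∣⁅x⁆∪p∣ p (x∉p ∘ there))
∣⁅x⁆∪p∣ {x = suc x} (outside Vec.∷ p) x∉p = ∣⁅x⁆∪p∣ p (x∉p ∘ there)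

∈-++⇔splitAt : (p : Subset m) (q : Subset n) (v : Fin (m + n)) →
  v ∈ p Vec.++ q ⇔ [ _∈ p , _∈ q ]′ (splitAt m v)
∈-++⇔splitAt Vec.[]      q v       = mk⇔ id id
∈-++⇔splitAt (_ Vec.∷ p) q zero    = mk⇔ (λ { here → here }) (λ { here → here })
∈-++⇔splitAt {m = suc m} (_ Vec.∷ p) q (suc v) with splitAt m v | ∈-++⇔splitAt p q v
... | inj₁ _ | eq = mk⇔ (λ { (there v∈) → there (to eq v∈) })
                        (λ { (there v∈) → there (from eq v∈) })
... | inj₂ _ | eq = mk⇔ (λ { (there v∈) → to eq v∈ }) (there ∘ from eq)

image : (Fin m → Fin n) → Subset m → Subset n
image f Vec.[]             = ⊥
image f (outside Vec.∷ b) = image (f ∘ suc) b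
image f (inside  Vec.∷ b) = ⁅ f zero ⁆ ∪ image (f ∘ suc) b

∈-image⁺ : (f : Fin m → Fin n) {b : Subset m} {l : Fin m} → l ∈ b → f l ∈ image f b
∈-image⁺ f here = x∈p∪q⁺ (inj₁ (x∈⁅x⁆ _))
∈-image⁺ f (there {y = outside} l∈b) = ∈-image⁺ (f ∘ suc) l∈b
∈-image⁺ f (there {y = inside}  l∈b) = x∈p∪q⁺ (inj₂ (∈-image⁺ (f ∘ suc) l∈b))

∈-image⁻ : (f : Fin m → Fin n) (b : Subset m) {v : Fin n} →
  v ∈ image f b → ∃[ l ] l ∈ b × v ≡ f l
∈-image⁻ f Vec.[] v∈ = contradiction v∈ ∉⊥
∈-image⁻ f (outside Vec.∷ b) v∈ with l , l∈b , eq ← ∈-image⁻ (f ∘ suc) b v∈ =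
  suc l , there l∈b , eq
∈-image⁻ f (inside Vec.∷ b) v∈ with x∈p∪q⁻ _ _ v∈
... | inj₁ v∈⁅⁆ = zero , here , x∈⁅y⁆⇒x≡y _ v∈⁅⁆
... | inj₂ v∈im with l , l∈b , eq ← ∈-image⁻ (f ∘ suc) b v∈im = suc l , there l∈b , eq

∣image∣ : (f : Fin m → Fin n) → Injective _≡_ _≡_ f → (b : Subset m) →
  ∣ image f b ∣ ≡ ∣ b ∣
∣image∣ {n = n} f inj Vec.[] = ∣⊥∣≡0 n
∣image∣ f inj (outside Vec.∷ b) = ∣image∣ (f ∘ suc) (suc-injectiveᶠ ∘ inj) b
∣image∣ f inj (inside Vec.∷ b) =
  trans (∣⁅x⁆∪p∣ (image (f ∘ suc) b) f0∉)
    (cong suc (∣image∣ (f ∘ suc) (suc-injectiveᶠ ∘ inj) b))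
  where
  f0∉ : ¬ f zero ∈ image (f ∘ suc) b
  f0∉ f0∈ with _ , _ , eq ← ∈-image⁻ (f ∘ suc) b f0∈ with () ← inj eq

-- Minimum dominating sets in the presence of pendants

module _ (G : Graph n) (hosts : List (Fin n)) where

  private
    host : Fin (length hosts) → Fin n
    host = lookup hosts

    H : Graph (n + length hosts)
    H = attachPendants G hosts

  -- For each `l`, `choice b` contains host `l` or its pendant, and either one dominates both.
  -- Domination by `choice b` is therefore a condition on the non-hosts alone.
  HostsSuffice : Subset (length hosts) → Set
  HostsSuffice b =
    ∀ v → (∃[ l ] v ≡ host l) ⊎ (∃[ l ] l ∈ b × Graph.Adj G v (host l))

  choice : Subset (length hosts) → Subset (n + length hosts)
  choice b = image host b Vec.++ ∁ b

  private
    _∈⊎_ : Fin n ⊎ Fin (length hosts) → Subset n × Subset (length hosts) → Set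
    V ∈⊎ (p , q) = [ _∈ p , _∈ q ]′ V

    -- Domination restated on the sum type on which `PendantAdj` is defined, so that proofs can
    -- match on old vertices and pendants instead of reasoning about `splitAt`.
    Dominating⊎ : Subset n → Subset (length hosts) → Set
    Dominating⊎ p q =
      ∀ V → V ∈⊎ (p , q) ⊎ (∃[ U ] U ∈⊎ (p , q) × PendantAdj G hosts V U)

    dominating⊎⁺ : ∀ p q → Dominating H (p Vec.++ q) → Dominating⊎ p q
    dominating⊎⁺ p q dom V with dom (join n _ V)
    ... | inj₁ v∈ =
      inj₁ (subst (_∈⊎ (p , q)) (splitAt-join n _ V) (to (∈-++⇔splitAt p q _) v∈))
    ... | inj₂ (u , u∈ , adj) =
      inj₂ (splitAt n u , to (∈-++⇔splitAt p q u) u∈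
           , subst (λ W → PendantAdj G hosts W (splitAt n u)) (splitAt-join n _ V) adj)

    dominating⊎⁻ : ∀ p q → Dominating⊎ p q → Dominating H (p Vec.++ q)
    dominating⊎⁻ p q dom v with dom (splitAt n v)
    ... | inj₁ v∈ = inj₁ (from (∈-++⇔splitAt p q v) v∈)
    ... | inj₂ (U , U∈ , adj) =
      inj₂ (join n _ U
           , from (∈-++⇔splitAt p q _) (subst (_∈⊎ (p , q)) (sym (splitAt-join n _ U)) U∈)
           , subst (PendantAdj G hosts (splitAt n v)) (sym (splitAt-join n _ U)) adj)

    -- The only neighbour of a pendant is its host, so a pendant missing from `q` forces its host
    -- into `p`.
    image∁⊆ : ∀ p q → Dominating⊎ p q → image host (∁ q) ⊆ p
    image∁⊆ p q dom v∈ with l , l∈∁q , refl ← ∈-image⁻ host (∁ q) v∈ with dom (inj₂ l)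
    ... | inj₁ l∈q                      = contradiction l∈q (x∈∁p⇒x∉p l∈∁q)
    ... | inj₂ (inj₁ _ , u∈p , refl)    = u∈p

  module _ (host-injective : Injective _≡_ _≡_ (lookup hosts)) where

    private
      ∣image∁∣+ : ∀ q → ∣ image host (∁ q) ∣ + ∣ q ∣ ≡ length hosts
      ∣image∁∣+ q = trans (cong (_+ ∣ q ∣) (∣image∣ host host-injective (∁ q)))
        (trans (+-comm ∣ ∁ q ∣ ∣ q ∣) (∣p∣+∣∁p∣≡n q))

      -- The pendants outside `q` have distinct hosts, all in `p`; together with `q` itself they
      -- account for one element of `D` per pendant.
      hosts≤∣D∣ : ∀ D → Dominating H D → length hosts ≤ ∣ D ∣
      hosts≤∣D∣ D dom with p , q , refl ← Vec.splitAt n D = begin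
        length hosts                     ≡⟨ ∣image∁∣+ q ⟨
        ∣ image host (∁ q) ∣ + ∣ q ∣     ≤⟨ +-monoˡ-≤ ∣ q ∣ (p⊆q⇒∣p∣≤∣q∣ image⊆p) ⟩
        ∣ p ∣ + ∣ q ∣                    ≡⟨ ∣p++q∣≡∣p∣+∣q∣ p q ⟨
        ∣ p Vec.++ q ∣                   ∎
        where
        open ≤-Reasoning

        image⊆p : image host (∁ q) ⊆ p
        image⊆p = image∁⊆ p q (dominating⊎⁺ p q dom)

      -- Equality in the lower bound leaves `p` no room beyond the hosts of the missing pendants.
      minimum⇒choice : ∀ D → Dominating H D → ∣ D ∣ ≡ length hosts →
        ∃[ b ] HostsSuffice b × D ≡ choice b
      minimum⇒choice D dom ∣D∣≡ with p , q , refl ← Vec.splitAt n D =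
        ∁ q , suffice , cong₂ Vec._++_ (sym image≡p) (sym (∁-involutive q))
        where
        dom⊎ : Dominating⊎ p q
        dom⊎ = dominating⊎⁺ p q dom

        image≡p : image host (∁ q) ≡ p
        image≡p = p⊆q∧∣q∣≤∣p∣⇒p≡q (image∁⊆ p q dom⊎) (≤-reflexive (+-cancelʳ-≡ ∣ q ∣ _ _
          (trans (sym (∣p++q∣≡∣p∣+∣q∣ p q)) (trans ∣D∣≡ (sym (∣image∁∣+ q))))))

        chosen : ∀ {v} → v ∈ p → ∃[ l ] l ∈ ∁ q × v ≡ host l
        chosen v∈p = ∈-image⁻ host (∁ q) (subst (_ ∈_) (sym image≡p) v∈p)

        suffice : HostsSuffice (∁ q)
        suffice v with dom⊎ (inj₁ v)
        ... | inj₁ v∈p with l , _ , eq ← chosen v∈p = inj₁ (l , eq)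
        ... | inj₂ (inj₁ u , u∈p , adj) with l , l∈ , refl ← chosen u∈p = inj₂ (l , l∈ , adj)
        -- A vertex dominated by a pendant is the host of that pendant.
        ... | inj₂ (inj₂ l , _ , eq) = inj₁ (l , eq)

      choice-dominating : ∀ b → HostsSuffice b → Dominating H (choice b)
      choice-dominating b suffice = dominating⊎⁻ (image host b) (∁ b) dom
        where
        dom : Dominating⊎ (image host b) (∁ b)
        dom (inj₂ l) with l ∈? b
        ... | yes l∈b = inj₂ (inj₁ (host l) , ∈-image⁺ host l∈b , refl)
        ... | no  l∉b = inj₁ (x∉p⇒x∈∁p l∉b)
        dom (inj₁ v) with suffice v
        ... | inj₂ (l , l∈b , adj) = inj₂ (inj₁ (host l) , ∈-image⁺ host l∈b , adj)
        ... | inj₁ (l , refl) with l ∈? b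
        ...   | yes l∈b = inj₁ (∈-image⁺ host l∈b)
        ...   | no  l∉b = inj₂ (inj₂ l , x∉p⇒x∈∁p l∉b , refl)

      ∣choice∣ : ∀ b → ∣ choice b ∣ ≡ length hosts
      ∣choice∣ b = trans (∣p++q∣≡∣p∣+∣q∣ (image host b) (∁ b))
        (trans (cong (_+ ∣ ∁ b ∣) (∣image∣ host host-injective b)) (∣p∣+∣∁p∣≡n b))

      -- The pendant half of `choice b` is `∁ b`, which determines `b`.
      choice-injective : ∀ {b c} → choice b ≡ choice c → b ≡ c
      choice-injective {b} {c} eq = trans (sym (∁-involutive b))
        (trans (cong ∁ (Vec.++-injectiveʳ (image host b) (image host c) eq)) (∁-involutive c))

    -- A single sufficient set of hosts attains the lower bound `hosts≤∣D∣`.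
    γ-attachPendants : ∀ b → HostsSuffice b → γ H ≡ length hosts
    γ-attachPendants b suffice = trans
      (f[argmin]≈f[v]⁺ {f = id}
        (∈-map⁺ ∣_∣ (∈-filter⁺ (dominating? H) (∈-subsets (choice b)) (choice-dominating b suffice)))
        (All.map⁺ (All.map (λ {D} dom → subst (_≤ ∣ D ∣) (sym (∣choice∣ b)) (hosts≤∣D∣ D dom))
          (All.all-filter (dominating? H) (subsets _))))
        -- The default value of `min` is the number of vertices of `H`, which no subset exceeds.
        (∣p∣≤n (choice b)))
      (∣choice∣ b)

    -- The bijection is `choice`. The predicate `P` is left open so that the count can be taken in a
    -- form suited to recursion, later `NoGap`.
    ζ-attachPendants : {P : Subset (length hosts) → Set} (P? : U.Decidable P) →
      (∀ b → P b ⇔ HostsSuffice b) → γ H ≡ length hosts →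
      ζ H ≡ length (filter P? (subsets (length hosts)))
    ζ-attachPendants P? P⇔ γ≡ = trans
      (unique∧set⇒length≡
        (Unique.filter⁺ size? (Unique.filter⁺ (dominating? H) (subsets-unique _)))
        (Unique.map⁺ choice-injective (Unique.filter⁺ P? (subsets-unique _)))
        (mk⇔ minimum⁺ minimum⁻))
      (length-map choice (filter P? (subsets (length hosts))))
      where
      size? = λ D → ∣ D ∣ ≟ γ H

      minimum⁺ : ∀ {D} → D ∈ˡ filter size? (dominatingSets H) →
        D ∈ˡ map choice (filter P? (subsets _))
      minimum⁺ {D} D∈
        with D∈dom , ∣D∣≡ ← ∈-filter⁻ size? {xs = dominatingSets H} D∈
        with b , suffice , refl ← minimum⇒choice D
               (proj₂ (∈-filter⁻ (dominating? H) {xs = subsets _} D∈dom)) (trans ∣D∣≡ γ≡) =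
        ∈-map⁺ choice (∈-filter⁺ P? (∈-subsets b) (from (P⇔ b) suffice))

      minimum⁻ : ∀ {D} → D ∈ˡ map choice (filter P? (subsets _)) →
        D ∈ˡ filter size? (dominatingSets H)
      minimum⁻ D∈ with b , b∈ , refl ← ∈-map⁻ choice D∈ =
        ∈-filter⁺ size?
          (∈-filter⁺ (dominating? H) (∈-subsets (choice b)) (choice-dominating b
            (to (P⇔ b) (proj₂ (∈-filter⁻ P? {xs = subsets _} b∈)))))
          (trans (∣choice∣ b) (sym γ≡))

-- Binary sequences without consecutive zeros

-- The sequence is extended by `x` in front and `y` behind, and no two neighbours of the extended
-- sequence may both be false. A true sentinel thus leaves its end free, while a false one forces
-- the entry next to it.
NoGap : Bool → Subset m → Bool → Set
NoGap x Vec.[]      y = T (x ∨ y)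
NoGap x (c Vec.∷ b) y = T (x ∨ c) × NoGap c b y

noGap? : ∀ x y → U.Decidable (λ (b : Subset m) → NoGap x b y)
noGap? x y Vec.[]      = T? (x ∨ y)
noGap? x y (c Vec.∷ b) = T? (x ∨ c) ×-dec noGap? c y b

bit : Bool → ℕ
bit false = 0
bit true  = 1

-- The first entry becomes the left sentinel of the rest. After a true sentinel both values are
-- allowed, which is the Fibonacci recurrence; after a false one only true is. In the base case
-- `F 0` is the count 0 for two false sentinels that touch.
count-noGap : ∀ x y m → length (filter (noGap? x y) (subsets m)) ≡ F (bit x + (m + bit y))
count-noGap false false zero = refl
count-noGap false true  zero = refl
count-noGap true  false zero = refl
count-noGap true  true  zero = refl
count-noGap x y (suc m) = begin
  length (filter (noGap? x y) (map (outside Vec.∷_) bs ++ map (inside Vec.∷_) bs))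
    ≡⟨ cong length (filter-++ (noGap? x y) (map (outside Vec.∷_) bs) _) ⟩
  length (filter (noGap? x y) (map (outside Vec.∷_) bs)
    ++ filter (noGap? x y) (map (inside Vec.∷_) bs))
    ≡⟨ length-++ (filter (noGap? x y) (map (outside Vec.∷_) bs)) ⟩
  length (filter (noGap? x y) (map (outside Vec.∷_) bs))
    + length (filter (noGap? x y) (map (inside Vec.∷_) bs))
    ≡⟨ cong₂ _+_ (length-filter-map (noGap? x y) _ bs) (length-filter-map (noGap? x y) _ bs) ⟩
  starting x outside + starting x inside
    ≡⟨ recurrence x ⟩
  F (bit x + (suc m + bit y)) ∎
  where
  open ≡-Reasoning
  bs = subsets m

  starting : Bool → Bool → ℕ
  starting x c = length (filter (noGap? x y ∘ (c Vec.∷_)) bs)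

  starting≡ : ∀ x c → T (x ∨ c) → starting x c ≡ F (bit c + (m + bit y))
  starting≡ x c x∨c = trans
    (cong length (filter-≐ _ (noGap? c y) (proj₂ , (x∨c ,_)) bs))
    (count-noGap c y m)

  recurrence : ∀ x → starting x outside + starting x inside ≡ F (bit x + (suc m + bit y))
  recurrence true  = trans (cong₂ _+_ (starting≡ true false _) (starting≡ true true _))
    (+-comm (F (m + bit y)) _)
  recurrence false = cong₂ _+_
    (cong length (filter-none (noGap? false y ∘ (outside Vec.∷_)) (All.universal (λ _ ()) bs)))
    (starting≡ false true _)

-- Taking every host is the witness for the value of `γ`. At least one entry is required to separate
-- two false sentinels.
noGap-⊤ : ∀ x y → 1 ≤ m → NoGap x (⊤ {m}) y
noGap-⊤ x y (s≤s {n = m} _) = T-∨true x , noGap-true m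
  where
  T-∨true : ∀ x → T (x ∨ true)
  T-∨true false = _
  T-∨true true  = _

  noGap-true : ∀ m → NoGap true (⊤ {m}) y
  noGap-true zero    = _
  noGap-true (suc m) = _ , noGap-true m

-- Gap i lies between the entries i - 1 and i of b.  The sentinels x and y stand before the
-- first and after the last entry; a true one closes its outer gap, which is then not counted.
IsGap : ℕ → Bool → Bool → ℕ → Set
IsGap m x y i = i ≤ m × (i ≡ 0 → x ≡ false) × (i ≡ m → y ≡ false)

-- The alternatives are the entries just after and just before gap `i`, in the order of the two
-- alternatives for adjacency on the path.
Borders : ℕ → Subset m → Set
Borders i b = ∃[ l ] l ∈ b × (i ≡ toℕ l ⊎ i ≡ suc (toℕ l))

borders-suc : ∀ {i c} {b : Subset m} → Borders i b → Borders (suc i) (c Vec.∷ b)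
borders-suc (l , l∈b , inj₁ eq) = suc l , there l∈b , inj₁ (cong suc eq)
borders-suc (l , l∈b , inj₂ eq) = suc l , there l∈b , inj₂ (cong suc eq)

noGap⇒borders : ∀ x y (b : Subset m) → NoGap x b y → ∀ i → IsGap m x y i → Borders i b
noGap⇒borders x y Vec.[] ok zero (_ , x≡ , y≡)
  -- With no entries, gap 0 lies between the two sentinels and is open only if both are false, which
  -- `NoGap` excludes.
  with refl ← x≡ refl | refl ← y≡ refl = ⊥-elim ok
noGap⇒borders x y (c Vec.∷ b) (x∨c , _) zero (_ , x≡ , _) with c | x≡ refl
... | true  | _    = zero , here , inj₁ refl
... | false | refl = ⊥-elim x∨c
noGap⇒borders x y (true Vec.∷ b) _ (suc zero) _ = zero , here , inj₂ refl
-- Gap 1 is gap 0 of the tail, and the false entry in front of it, now the left sentinel, keeps it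
-- open.
noGap⇒borders x y (false Vec.∷ b) (_ , ok) (suc zero) (i≤m , _ , y≡) =
  borders-suc (noGap⇒borders false y b ok zero (s≤s⁻¹ i≤m , (λ _ → refl) , y≡ ∘ cong suc))
noGap⇒borders x y (c Vec.∷ b) (_ , ok) (suc (suc i)) (i≤m , _ , y≡) =
  borders-suc (noGap⇒borders c y b ok (suc i) (s≤s⁻¹ i≤m , (λ ()) , y≡ ∘ cong suc))

borders⇒noGap : ∀ x y (b : Subset m) → (∀ i → IsGap m x y i → Borders i b) → NoGap x b y
borders⇒noGap true  y     Vec.[] _ = _
borders⇒noGap false true  Vec.[] _ = _
borders⇒noGap false false Vec.[] borders
  with () ← proj₁ (borders 0 (z≤n , (λ _ → refl) , (λ _ → refl)))
borders⇒noGap {m = suc m} x y (c Vec.∷ b) borders =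
  x∨c x c borders , borders⇒noGap c y b tail
  where
  x∨c : ∀ x c → (∀ i → IsGap (suc m) x y i → Borders i (c Vec.∷ b)) → T (x ∨ c)
  x∨c true  c     _ = _
  x∨c false true  _ = _
  x∨c false false borders with borders 0 (z≤n , (λ _ → refl) , λ ())
  ... | suc l , _ , inj₁ ()
  ... | suc l , _ , inj₂ ()

  tail : ∀ i → IsGap m c y i → Borders i b
  tail i (i≤m , c≡ , y≡)
    with borders (suc i) (s≤s i≤m , (λ ()) , y≡ ∘ suc-injective)
  -- If entry 0 borders gap `suc i`, then `i` is 0 and `c` is true, but a true `c` closes gap 0 of
  -- the tail.
  ... | zero  , here , inj₂ refl with () ← c≡ refl
  ... | suc l , there l∈b , inj₁ eq = l , l∈b , inj₁ (suc-injective eq)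
  ... | suc l , there l∈b , inj₂ eq = l , l∈b , inj₂ (suc-injective eq)

-- Paths with pendants at every other vertex

parity : ∀ n → ∃[ r ] n ≡ bit r + ⌊ n /2⌋ * 2
parity zero          = false , refl
parity (suc zero)    = true , refl
parity (suc (suc n)) with parity n
... | false , eq = false , cong (λ k → suc (suc k)) eq
... | true  , eq = true  , cong (λ k → suc (suc k)) eq

*2≢suc*2 : ∀ i j → ¬ i * 2 ≡ suc (j * 2)
*2≢suc*2 (suc i) (suc j) eq = *2≢suc*2 i j (suc-injective (suc-injective eq))

m+bit≤1+m : ∀ m x → m + bit x ≤ suc m
m+bit≤1+m m false = subst (_≤ suc m) (sym (+-identityʳ m)) (n≤1+n m)
m+bit≤1+m m true  = ≤-reflexive (+-comm m 1)

m<m+bit-not⇒false : ∀ m x → m < m + bit (not x) → x ≡ false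
m<m+bit-not⇒false m false _   = refl
m<m+bit-not⇒false m true  m<m = contradiction m<m (<-irrefl (sym (+-identityʳ m)))

0<bit-not⇒false : ∀ {x k} → suc k ≡ bit (not x) + 0 → x ≡ false
0<bit-not⇒false {false} _ = refl

-- Hosts occupy the positions with the parity of `bit (not x)`, gaps the others. Writing `suc p`
-- avoids subtracting 1 from the position of a gap.
host⊎gap-position : ∀ x p → (∃[ l ] p ≡ bit (not x) + l * 2) ⊎
                            (∃[ i ] suc p ≡ bit (not x) + i * 2)
host⊎gap-position x p with x | parity p
... | true  | false , eq = inj₁ (⌊ p /2⌋ , eq)
-- When the path starts at a host, gap 0 would lie before the first vertex, so the vertex at
-- position 1 is gap 1.
... | true  | true  , eq = inj₂ (suc ⌊ p /2⌋ , cong suc eq)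
... | false | false , eq = inj₂ (⌊ p /2⌋ , cong suc eq)
... | false | true  , eq = inj₁ (⌊ p /2⌋ , eq)

-- The path starts (ends) at a host if x (if y) is true.  Host l is at position s + 2l and
-- gap i is at position s + 2i - 1, where s = bit (not x).
module _ (x y : Bool) (hosts : List (Fin n)) where

  private
    s = bit (not x)
    m₀ = length hosts

  module _ (position : ∀ l → toℕ (lookup hosts l) ≡ s + toℕ l * 2)
    -- If `y` is true, the last host, at `s + 2(m₀ - 1)`, is the last vertex, of position `n - 1`;
    -- otherwise one vertex, gap `m₀`, follows it.
    (size : suc n ≡ s + (m₀ * 2 + bit (not y))) where

    hosts-injective : Injective _≡_ _≡_ (lookup hosts)
    hosts-injective {l} {l′} eq = toℕ-injective (*-cancelʳ-≡ _ _ 2 (+-cancelˡ-≡ s _ _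
      (trans (sym (position l)) (trans (cong toℕ eq) (position l′)))))

    private
      -- The last gap `m₀` is counted only for false `y`, and then `bit (not y)` makes the
      -- inequality strict.
      gap-bound : ∀ {i} → IsGap m₀ x y i → i * 2 < m₀ * 2 + bit (not y)
      gap-bound {i} (i≤m , _ , y≡) with m≤n⇒m<n∨m≡n i≤m
      ... | inj₁ i<m  = <-≤-trans (*-monoˡ-< 2 i<m) (m≤m+n _ _)
      ... | inj₂ refl rewrite y≡ refl = m<m+n _ (s≤s z≤n)

      gap-positive : ∀ x i → (i ≡ 0 → x ≡ false) → ∃[ p ] suc p ≡ bit (not x) + i * 2
      gap-positive false i       _  = i * 2 , refl
      gap-positive true  zero    x≡ with () ← x≡ refl
      gap-positive true  (suc i) _  = suc (i * 2) , refl

      gap-vertex : ∀ i → IsGap m₀ x y i → ∃[ v ] suc (toℕ {n} v) ≡ s + i * 2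
      gap-vertex i gap@(_ , x≡ , _) with p , p≡ ← gap-positive x i x≡ =
        fromℕ< p<n , trans (cong suc (toℕ-fromℕ< p<n)) p≡
        where
        p<n : p < n
        p<n = s≤s⁻¹ (subst₂ _<_ (sym p≡) (sym size) (+-monoʳ-< s (gap-bound gap)))

      position-bound : ∀ {i} → s + i < suc n → i < m₀ * 2 + bit (not y)
      position-bound {i} s+i<1+n = +-cancelˡ-< s _ _ (subst (s + i <_) size s+i<1+n)

      host-at : ∀ l (v : Fin n) → toℕ v ≡ s + l * 2 → ∃[ l ] v ≡ lookup hosts l
      host-at l v v≡ = fromℕ< l<m , toℕ-injective (trans v≡
        (trans (cong (λ l → s + l * 2) (sym (toℕ-fromℕ< l<m))) (sym (position _))))
        where
        l<m : l < m₀
        l<m = *-cancelʳ-< 2 _ _ (s≤s⁻¹ (<-≤-trans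
          (position-bound (subst (_< suc n) (trans (cong suc v≡) (sym (+-suc s _))) (s≤s (toℕ<n v))))
          (m+bit≤1+m (m₀ * 2) (not y))))

      gap-at : ∀ i (v : Fin n) → suc (toℕ v) ≡ s + i * 2 → IsGap m₀ x y i
      gap-at i v v≡ =
        *-cancelʳ-≤ i m₀ 2 (s≤s⁻¹ (<-≤-trans bound (m+bit≤1+m (m₀ * 2) (not y)))) ,
        (λ { refl → 0<bit-not⇒false v≡ }) ,
        (λ { refl → m<m+bit-not⇒false (m₀ * 2) y bound })
        where
        bound : i * 2 < m₀ * 2 + bit (not y)
        bound = position-bound (subst (_< suc n) v≡ (s≤s (toℕ<n v)))

      host⊎gap : ∀ (v : Fin n) → (∃[ l ] v ≡ lookup hosts l) ⊎
        (∃[ i ] IsGap m₀ x y i × suc (toℕ v) ≡ s + i * 2)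
      host⊎gap v with host⊎gap-position x (toℕ v)
      ... | inj₁ (l , v≡) = inj₁ (host-at l v v≡)
      ... | inj₂ (i , v≡) = inj₂ (i , gap-at i v v≡ , v≡)

      adjacent⇔borders : ∀ i l (v : Fin n) → suc (toℕ v) ≡ s + i * 2 →
        Graph.Adj (path n) v (lookup hosts l) ⇔ (i ≡ toℕ l ⊎ i ≡ suc (toℕ l))
      adjacent⇔borders i l v v≡ = mk⇔ adj⇒ ⇒adj
        where
        2+position : suc (suc (toℕ (lookup hosts l))) ≡ s + suc (toℕ l) * 2
        2+position = trans (cong (λ p → suc (suc p)) (position l))
          (sym (trans (+-suc s _) (cong suc (+-suc s _))))

        cancel : ∀ {i j} → s + i * 2 ≡ s + j * 2 → i ≡ j
        cancel = *-cancelʳ-≡ _ _ 2 ∘ +-cancelˡ-≡ s _ _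

        adj⇒ : Graph.Adj (path n) v (lookup hosts l) → i ≡ toℕ l ⊎ i ≡ suc (toℕ l)
        adj⇒ (inj₁ eq) = inj₁ (cancel (trans (sym v≡) (trans eq (position l))))
        adj⇒ (inj₂ eq) = inj₂ (cancel (trans (sym v≡) (trans (cong suc (sym eq)) 2+position)))

        ⇒adj : i ≡ toℕ l ⊎ i ≡ suc (toℕ l) → Graph.Adj (path n) v (lookup hosts l)
        ⇒adj (inj₁ refl) = inj₁ (trans v≡ (sym (position l)))
        ⇒adj (inj₂ refl) = inj₂ (suc-injective (trans 2+position (sym v≡)))

    -- The non-hosts are exactly the vertices at open gaps, and their neighbours on the path among
    -- the hosts are the entries bordering the gap.
    noGap⇔hostsSuffice : ∀ b → NoGap x b y ⇔ HostsSuffice (path n) hosts b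
    noGap⇔hostsSuffice b = mk⇔ suffice (borders⇒noGap x y b ∘ borders)
      where
      suffice : NoGap x b y → HostsSuffice (path n) hosts b
      suffice ok v with host⊎gap v
      ... | inj₁ host = inj₁ host
      ... | inj₂ (i , gap , v≡) with l , l∈b , eq ← noGap⇒borders x y b ok i gap =
        inj₂ (l , l∈b , from (adjacent⇔borders i l v v≡) eq)

      borders : HostsSuffice (path n) hosts b →
        ∀ i → IsGap m₀ x y i → Borders i b
      borders suffice i gap with v , v≡ ← gap-vertex i gap with suffice v
      ... | inj₂ (l , l∈b , adj) = l , l∈b , to (adjacent⇔borders i l v v≡) adj
      -- A gap vertex is not a host, by parity of positions.
      ... | inj₁ (l , refl) = contradiction
        (+-cancelˡ-≡ s _ _ (trans (sym v≡) (trans (cong suc (position l)) (sym (+-suc s _)))))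
        (*2≢suc*2 i (toℕ l))

    γ-path : 1 ≤ m₀ → γ (attachPendants (path n) hosts) ≡ m₀
    γ-path 1≤m = γ-attachPendants (path n) hosts hosts-injective ⊤
      (to (noGap⇔hostsSuffice ⊤) (noGap-⊤ x y 1≤m))

    ζ-path : 1 ≤ m₀ → ζ (attachPendants (path n) hosts) ≡ F (bit x + (m₀ + bit y))
    ζ-path 1≤m = trans
      (ζ-attachPendants (path n) hosts hosts-injective (noGap? x y) noGap⇔hostsSuffice
        (γ-path 1≤m))
      (count-noGap x y m₀)

-- Positions of the even and odd vertices.

lookup-positions : (h : A → B) (f : ℕ → B) (xs : List A) (m : ℕ) → map h xs ≡ applyUpTo f m →
  length xs ≡ m × (∀ l → h (lookup xs l) ≡ f (toℕ l))
lookup-positions h f []       zero    _  = refl , λ ()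
lookup-positions h f (x ∷ xs) (suc m) eq
  with len , pos ← lookup-positions h (f ∘ suc) xs m (∷-injectiveʳ eq) =
  cong suc len , λ { zero → ∷-injectiveˡ eq ; (suc l) → pos l }

γ,ζ-path : ∀ x y (hosts : List (Fin n)) m → 1 ≤ m →
  map toℕ hosts ≡ applyUpTo (λ l → bit (not x) + l * 2) m →
  suc n ≡ bit (not x) + (m * 2 + bit (not y)) →
  γ (attachPendants (path n) hosts) ≡ m ×
  ζ (attachPendants (path n) hosts) ≡ F (bit x + (m + bit y))
γ,ζ-path x y hosts m 1≤m hosts≡ size
  with refl , position ← lookup-positions toℕ _ hosts m hosts≡ =
  γ-path x y hosts position size 1≤m , ζ-path x y hosts position size 1≤m

module _ {P : A → Set} (P? : U.Decidable P) where

  -- When the predicate alternates along `f`, dropping the first term exchanges the two cases, so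
  -- they are proved together for an arbitrary sequence `f`.
  filter-alternate⁺ : (f : ℕ → A) → (∀ k → P (f (suc k)) ⇔ (¬ P (f k))) → P (f 0) →
    ∀ n → filter P? (tabulate {n = n} (f ∘ toℕ)) ≡ applyUpTo (λ l → f (l * 2)) ⌈ n /2⌉
  filter-alternate⁻ : (f : ℕ → A) → (∀ k → P (f (suc k)) ⇔ (¬ P (f k))) → ¬ P (f 0) →
    ∀ n → filter P? (tabulate {n = n} (f ∘ toℕ)) ≡ applyUpTo (λ l → f (suc (l * 2))) ⌊ n /2⌋

  filter-alternate⁺ f alt p zero    = refl
  filter-alternate⁺ f alt p (suc n) = trans (filter-accept P? p) (cong (f 0 ∷_)
    (filter-alternate⁻ (f ∘ suc) (alt ∘ suc) (λ q → to (alt 0) q p) n))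

  filter-alternate⁻ f alt ¬p zero    = refl
  filter-alternate⁻ f alt ¬p (suc n) = trans (filter-reject P? ¬p)
    (filter-alternate⁺ (f ∘ suc) (alt ∘ suc) (from (alt 0) ¬p) n)

map-toℕ-filter-allFin : {P : ℕ → Set} (P? : U.Decidable P) (n : ℕ) →
  map toℕ (filter (P? ∘ toℕ) (allFin n)) ≡ filter P? (tabulate {n = n} toℕ)
map-toℕ-filter-allFin P? n =
  trans (map-filter P? toℕ (allFin n)) (cong (filter P?) (map-tabulate {n = n} id toℕ))

2∣suc⇔2∤ : ∀ k → 2 ∣ suc k ⇔ (¬ 2 ∣ k)
2∣suc⇔2∤ k = mk⇔ (λ { (divides i eq) (divides j refl) → *2≢suc*2 i j (sym eq) }) 2∤⇒2∣suc
  where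
  2∤⇒2∣suc : ¬ 2 ∣ k → 2 ∣ suc k
  2∤⇒2∣suc 2∤k with parity k
  ... | false , eq = contradiction (divides ⌊ k /2⌋ eq) 2∤k
  ... | true  , eq = divides (suc ⌊ k /2⌋) (cong suc eq)

⌈n/2⌉≡ : ∀ r n → n ≡ bit r + ⌊ n /2⌋ * 2 → ⌈ n /2⌉ ≡ bit r + ⌊ n /2⌋
⌈n/2⌉≡ r n n≡ = +-cancelˡ-≡ k _ _ (begin
  k + ⌈ n /2⌉           ≡⟨ ⌊n/2⌋+⌈n/2⌉≡n n ⟩
  n                     ≡⟨ n≡ ⟩
  bit r + k * 2         ≡⟨ cong (bit r +_) (trans (*-comm k 2) (cong (k +_) (+-identityʳ k))) ⟩
  bit r + (k + k)       ≡⟨ +-assoc (bit r) k k ⟨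
  bit r + k + k         ≡⟨ +-comm (bit r + k) k ⟩
  k + (bit r + k)       ∎)
  where
  open ≡-Reasoning
  k = ⌊ n /2⌋

-- The two families of graphs.

γ,ζ-E : ∀ r n → 2 ≤ n → n ≡ bit r + ⌊ n /2⌋ * 2 →
  γ (E n) ≡ ⌊ n /2⌋ × ζ (E n) ≡ F (⌊ n /2⌋ + bit (not r))
-- The path starts at the non-host of index 1, and it ends at a host exactly when `n` is even, that
-- is, when `r` is false.
γ,ζ-E r n 2≤n n≡ = γ,ζ-path false (not r) (evenVertices n) ⌊ n /2⌋ (⌊n/2⌋-mono 2≤n)
  (trans
    (map-toℕ-filter-allFin (λ k → 2 ∣? suc k) n)
    -- Position `k` has index `suc k`, so the first test is whether 2 divides 1; it fails because 2
    -- divides 2.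
    (filter-alternate⁻ _ id (2∣suc⇔2∤ ∘ suc) (to (2∣suc⇔2∤ 1) ∣-refl) n))
  (cong suc (trans n≡ (trans (+-comm (bit r) _)
    (cong (λ r → ⌊ n /2⌋ * 2 + bit r) (sym (not-involutive r))))))

γ,ζ-O : ∀ r n → 2 ≤ n → n ≡ bit r + ⌊ n /2⌋ * 2 →
  γ (O n) ≡ ⌈ n /2⌉ × ζ (O n) ≡ F (suc (⌈ n /2⌉ + bit r))
-- The path starts at a host, and it ends at one exactly when `n` is odd.
γ,ζ-O r n 2≤n n≡ = γ,ζ-path true r (oddVertices n) ⌈ n /2⌉ (⌈n/2⌉-mono 2≤n)
  (trans
    (map-toℕ-filter-allFin (λ k → ¬? (2 ∣? suc k)) n)
    (filter-alternate⁺ _ id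
      (λ k → mk⇔ (λ ¬even odd → ¬even (from (2∣suc⇔2∤ (suc k)) odd))
                 (λ ¬odd even → ¬odd (to (2∣suc⇔2∤ (suc k)) even)))
      (to (2∣suc⇔2∤ 1) ∣-refl) n))
  (trans (cong suc n≡) (trans (1+bit+k*2 r ⌊ n /2⌋)
    (cong (λ c → c * 2 + bit (not r)) (sym (⌈n/2⌉≡ r n n≡)))))
  where
  1+bit+k*2 : ∀ r k → suc (bit r + k * 2) ≡ (bit r + k) * 2 + bit (not r)
  1+bit+k*2 false k = +-comm 1 (k * 2)
  1+bit+k*2 true  k = sym (+-identityʳ _)

theorem8 : (n k : ℕ) → 2 ≤ n → k ≡ ⌊ n /2⌋ →
    ((γ (E n) ≡ k)
    × (n ≡ 2 * k → ζ (E n) ≡ F (k + 1))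
    × (n ≡ 2 * k + 1 → ζ (E n) ≡ F k))
    × ((γ (O n) ≡ ⌈ n /2⌉)
    × (n ≡ 2 * k → ζ (O n) ≡ F (k + 1))
    × (n ≡ 2 * k + 1 → ζ (O n) ≡ F (k + 3)))
theorem8 n k 2≤n refl =
  ( proj₁ (γ,ζ-E _ n 2≤n (proj₂ (parity n)))
  , (λ n≡2k → proj₂ (γ,ζ-E false n 2≤n (even n≡2k)))
  , (λ n≡2k+1 → trans (proj₂ (γ,ζ-E true n 2≤n (odd n≡2k+1))) (cong F (+-identityʳ k))) )
  ,
  ( proj₁ (γ,ζ-O _ n 2≤n (proj₂ (parity n)))
  , (λ n≡2k → trans (proj₂ (γ,ζ-O false n 2≤n (even n≡2k)))
      (cong F (trans (cong (λ c → suc (c + 0)) (⌈n/2⌉≡ false n (even n≡2k)))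
        (trans (cong suc (+-identityʳ k)) (+-comm 1 k)))))
  , (λ n≡2k+1 → trans (proj₂ (γ,ζ-O true n 2≤n (odd n≡2k+1)))
      -- For odd `n` there are `k + 1` hosts, and each end of the path, being a host, adds one to
      -- the index.
      (cong F (trans (cong (λ c → suc (c + 1)) (⌈n/2⌉≡ true n (odd n≡2k+1)))
        (trans (cong (λ c → suc (suc c)) (+-comm k 1)) (+-comm 3 k))))) )
  where
  even : n ≡ 2 * k → n ≡ k * 2
  even n≡2k = trans n≡2k (*-comm 2 k)

  odd : n ≡ 2 * k + 1 → n ≡ suc (k * 2)
  odd n≡2k+1 = trans n≡2k+1 (trans (+-comm _ 1) (cong suc (*-comm 2 k)))
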